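{- For all integers $j,k\ge0$, $$\begin{aligned}A_{j,k,2}={}&2k(k-1)\,D_{2j,k}\\&+4(k-1)(4j-4k+5)\,D_{2j,k-1}\\&+16(j-k+2)(2j-2k+3)\,D_{2j,k-2}.\end{aligned}$$
   Context: For $n\ge1$, $\mathfrak B_n$ is the hyperoctahedral group of signed permutations: words $\pi=\pi_1\cdots\pi_n$ of nonzero integers such that $|\pi_1|,\dots,|\pi_n|$ is a permutation of $[n]=\{1,\dots,n\}$, with $\pi(i)=\pi_i$, $\pi(-i)=-\pi(i)$. $\mathcal I_n^B$ is the set of $\pi\in\mathfrak B_n$ with $\pi^2=\mathrm{id}$ (for $n=0$, a single empty involution). With $\pi_0=0$ and the usual order on $\mathbb Z$, $\operatorname{des}^B(\pi)=\#\{0\le i\le n-1:\pi_i>\pi_{i+1}\}$, and $\operatorname{fix}_B(\pi)=\#\{i\in[n]:|\pi(i)|=i\}$. Let $J_{2j}^B(t)=\sum t^{\operatorname{des}^B(\pi)}$ over $\pi\in\mathcal I_{2j}^B$ with $\operatorname{fix}_B(\pi)=0$, and let $P_j(x)=\sum_{s=0}^jD_{2j,s}x^s$ be the unique polynomial with $J_{2j}^B(t)=(1+t)^{2j}P_j\!\left(\frac{t}{(1+t)^2}\right)$ (it exists because $J_{2j}^B$ is palindromic with center $j$). Convention: $D_{2j,s}=0$ for $s<0$ or $s>j$. The numbers $A_{j,k,r}$ are the coefficients in $A_{j,r}(x)=\sum_kA_{j,k,r}x^k$, where $$\sum_{r\ge0}A_{j,r}(x)W^r=(1+4xW)^{2j}\,P_j\!\left(\frac{x(1+2W+4xW^2)}{(1+4xW)^2}\right).$$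 -}

module Defs where

open import Algebra.Bundles.Raw using (RawRing)
import Algebra.Definitions.RawSemiring as RawSemiringDefs
open import Data.Fin using (Fin; zero; suc; toℕ; inject₁)
import Data.Fin.Properties as Fin
open import Data.Integer as ℤ using (ℤ; +_; -[1+_]; _◃_)
open import Data.Integer.Properties as ℤ using ()
open import Data.List using (List; []; _∷_; [_]; length; filter; foldr; map; allFin; cartesianProduct; cartesianProductWith)
open import Data.List.Relation.Unary.Unique.Propositional using (Unique)
open import Data.List.Relation.Unary.AllPairs using (allPairs?)
open import Data.Nat as ℕ using (ℕ; zero; suc; _∸_)
open import Data.Product using (_×_; _,_; proj₂)
open import Data.Product.Properties as Product using ()
open import Data.Sign as Sign using (Sign)
open import Data.Sign.Properties as Sign using ()
open import Data.Vec as Vec using (Vec; []; _∷_; lookup; toList; tabulate)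
open import Data.Vec.Functional using (Vector)
open import Data.Vec.Properties as Vec using ()
open import Level using (Level; 0ℓ)
open import Relation.Binary.PropositionalEquality using (_≡_)
open import Relation.Nullary using (Dec; ¬?)
open import Relation.Nullary.Decidable using (map′; _×-dec_)

private variable
  c ℓ : Level
  n : ℕ

------------------------------------------------------------------------
-- Signed permutations

-- The letter (s , i) stands for the nonzero integer s·(i+1), because
-- Fin n is {0,…,n-1} while [n] is {1,…,n}.
Letter : ℕ → Set
Letter n = Sign × Fin n

⟦_⟧ : Letter n → ℤ
⟦ s , i ⟧ = s ◃ suc (toℕ i)

∣_∣ : Letter n → Fin n
∣_∣ = proj₂

Word : ℕ → Set
Word n = Vec (Letter n) n

-- Distinctness is enough: n pairwise distinct elements of [n] form a
-- permutation of [n].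
IsSignedPermutation : Word n → Set
IsSignedPermutation w = Unique (map ∣_∣ (toList w))

-- π(i) = πᵢ and π(-i) = -π(i)
apply : Word n → Letter n → Letter n
apply w (s , i) with lookup w i
... | s′ , i′ = s Sign.* s′ , i′

infixr 9 _∘ᴮ_
_∘ᴮ_ : Word n → Word n → Word n
π ∘ᴮ σ = Vec.map (apply π) σ

idᴮ : Word n
idᴮ = tabulate (λ i → Sign.+ , i)

record IsInvolution (π : Word n) : Set where
  constructor _,_
  field
    signedPermutation : IsSignedPermutation π
    squaresToId       : π ∘ᴮ π ≡ idᴮ

isInvolution? : (π : Word n) → Dec (IsInvolution π)
isInvolution? π = map′
  (λ (p , q) → p , q) (λ (p , q) → p , q)
  (allPairs? (λ i j → ¬? (i Fin.≟ j)) (map ∣_∣ (toList π))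
   ×-dec Vec.≡-dec (Product.≡-dec Sign._≟_ Fin._≟_) (π ∘ᴮ π) idᴮ)

desᴮ : Word n → ℕ
desᴮ {n} π = length (filter (λ i → lookup π₀ (suc i) ℤ.<? lookup π₀ (inject₁ i)) (allFin n))
  where
  π₀ : Vec ℤ (suc n)
  π₀ = + 0 ∷ Vec.map ⟦_⟧ π

fixᴮ : Word n → ℕ
fixᴮ {n} π = length (filter (λ i → ∣ apply π (Sign.+ , i) ∣ Fin.≟ i) (allFin n))

letters : ∀ n → List (Letter n)
letters n = cartesianProduct (Sign.+ ∷ Sign.- ∷ []) (allFin n)

vectors : {A : Set} → List A → ∀ m → List (Vec A m)
vectors as zero    = [ [] ]
vectors as (suc m) = cartesianProductWith _∷_ as (vectors as m)

words : ∀ n → List (Word n)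
words n = vectors (letters n) n

involutions : ∀ n → List (Word n)
involutions n = filter isInvolution? (words n)

fixedPointFreeInvolutions : ∀ n → List (Word n)
fixedPointFreeInvolutions n = filter (λ π → fixᴮ π ℕ.≟ 0) (involutions n)

------------------------------------------------------------------------
-- Formal power series

module RingOps (R : RawRing c ℓ) where
  open RawRing R public
  open RawSemiringDefs rawSemiring public using (_^_; sum) renaming (_×_ to _·_)

-- f : ℕ → R is the series Σₙ f n · Xⁿ, and products are Cauchy products.
R⟦X⟧ : RawRing c ℓ → RawRing c ℓ
R⟦X⟧ R = record
  { Carrier = ℕ → Carrier
  ; _≈_     = λ f g → ∀ n → f n ≈ g n
  ; _+_     = λ f g n → f n + g n
  ; _*_     = λ f g n → sum {suc n} (λ i → f (toℕ i) * g (n ∸ toℕ i))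
  ; -_      = λ f n → - f n
  ; 0#      = λ _ → 0#
  ; 1#      = λ { zero → 1# ; (suc _) → 0# }
  }
  where open RingOps R

module PowerSeries (R : RawRing c ℓ) where
  open RingOps (R⟦X⟧ R) public
  private module R = RawRing R

  const : R.Carrier → Carrier
  const a zero    = a
  const a (suc _) = R.0#

  X : Carrier
  X 1 = R.1#
  X _ = R.0#

  -- The geometric series Σₘ (1 - f)ᵐ. It is only meaningful, and then
  -- inverse to f, when f has constant coefficient 1; in that case (1 - f)ᵐ
  -- has no terms of degree below m, so m ≤ n suffices for coefficient n.
  infix 9 _⁻¹
  _⁻¹ : Carrier → Carrier
  (f ⁻¹) n = sum {suc n} (λ m → (1# + - f) ^ toℕ m) n

  infixl 7 _/_
  _/_ : Carrier → Carrier → Carrier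
  f / g = f * g ⁻¹

------------------------------------------------------------------------
-- Polynomials with integer coefficients

-- p : Vector ℤ n is the polynomial Σ_{s<n} p s · xˢ; ι embeds ℤ in R.
eval : (R : RawRing c ℓ) → (ℤ → RawRing.Carrier R) →
       Vector ℤ n → RawRing.Carrier R → RawRing.Carrier R
eval R ι p u = sum (λ s → ι (p s) * u ^ toℕ s)
  where open RingOps R

-- Coefficients, extended by zero to all integer exponents.
coeff : Vector ℤ n → ℤ → ℤ
coeff {zero}  p _           = + 0
coeff {suc n} p (+ zero)    = p zero
coeff {suc n} p (+ (suc s)) = coeff (λ i → p (suc i)) (+ s)
coeff {suc n} p -[1+ _ ]    = + 0

------------------------------------------------------------------------
-- The polynomials J, P and A

ℤʳ : RawRing 0ℓ 0ℓ
ℤʳ = ℤ.+-*-rawRing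

module _ where
  open PowerSeries ℤʳ renaming (X to t)

  -- Jᴮ n is J_n^B(t).
  Jᴮ : ℕ → Carrier
  Jᴮ n = foldr _+_ 0# (map (λ π → t ^ desᴮ π) (fixedPointFreeInvolutions n))

  -- The identity J_{2j}^B(t) = (1+t)^{2j} P(t/(1+t)²) determining P_j. It is
  -- read in ℤ⟦t⟧, where 1+t is invertible.
  IsP : (j : ℕ) → Vector ℤ (suc j) → Set
  IsP j P = Jᴮ (2 ℕ.* j) ≈ (1# + t) ^ (2 ℕ.* j) * eval (R⟦X⟧ ℤʳ) const P (t / (1# + t) ^ 2)

module _ where
  private module ℤ⟦x⟧ = PowerSeries ℤʳ
  open PowerSeries (R⟦X⟧ ℤʳ) renaming (X to W)

  private
    x : Carrier
    x = const ℤ⟦x⟧.X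

  -- Σᵣ A_{j,r}(x) Wʳ as an element of ℤ⟦x⟧⟦W⟧.
  generatingFunction : (j : ℕ) → Vector ℤ (suc j) → Carrier
  generatingFunction j P =
    (1# + 4 · (x * W)) ^ (2 ℕ.* j)
    * eval (R⟦X⟧ (R⟦X⟧ ℤʳ)) (λ a → const (ℤ⟦x⟧.const a)) P
        ((x * (1# + 2 · W + 4 · (x * W ^ 2))) / (1# + 4 · (x * W)) ^ 2)

  -- A j P k r is A_{j,k,r}, the coefficient of xᵏ in A_{j,r}(x).
  A : (j : ℕ) → Vector ℤ (suc j) → (k r : ℕ) → ℤ
  A j P k r = generatingFunction j P r k

{-# OPTIONS --safe #-}
module Submission where

-- By linearity it suffices to treat P = xˢ with s ≤ j. Put E = 1 + 4xW and
-- N = 1 + 2W + 4xW². Since s ≤ j the denominators cancel,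
--   E²ʲ (xN/E²)ˢ = xˢ E²⁽ʲ⁻ˢ⁾ Nˢ,
-- and the W²-coefficient of the right-hand side is
--   2s(s-1) xˢ + 4s(4j-4s+1) xˢ⁺¹ + 16(j-s)(2j-2s-1) xˢ⁺².
-- Reading off xᵏ selects s = k, k-1 and k-2.

open import Defs using (IsP; A; coeff; R⟦X⟧; ℤʳ; generatingFunction; module RingOps; module PowerSeries)
open import Algebra.Bundles using (CommutativeRing)
open import Algebra.Bundles.Raw using (RawRing)
open import Algebra.Structures using (IsCommutativeRing)
import Algebra.Construct.Pointwise as Pointwise
import Algebra.Properties.Semiring.Sum as SemiringSum
import Algebra.Properties.Semiring.Exp as SemiringExp
import Algebra.Properties.Semiring.Mult as SemiringMult
import Algebra.Solver.Ring.NaturalCoefficients.Default as SemiringSolver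
open import Data.Fin using (Fin; toℕ)
open import Data.Fin.Properties using (toℕ<n)
open import Data.Nat using (ℕ; zero; suc; z≤n; s≤s)
import Data.Nat as ℕ
import Data.Nat.Properties as ℕ
import Data.Integer as ℤ
import Data.Integer.Properties as ℤ
open import Data.Integer using (ℤ; +_)
open import Data.Nat.Combinatorics using (_C_; nC1≡n; nCk+nC[k+1]≡[n+1]C[k+1])
open import Data.Product using (Σ; _,_; proj₁; proj₂)
open import Data.Vec.Functional using (Vector)
open import Function using (_∘_)
open import Level using (Level)
open import Relation.Binary.PropositionalEquality as ≡ using (_≡_)

private variable
  c ℓ : Level

-- Geometric sums and cancellation of denominators in a commutative ring.

module RingIdentities (R : CommutativeRing c ℓ) where
  open CommutativeRing R
  open import Relation.Binary.Reasoning.Setoid setoid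
  open SemiringSolver commutativeSemiring using (solve; _:=_; _:+_; _:*_; con)
  open SemiringSum semiring using (sum; *-distribˡ-sum)
  open import Algebra.Properties.CommutativeSemiring.Exp commutativeSemiring
    using (_^_; ^-congˡ; ^-congʳ; ^-homo-*; ^-assocʳ; ^-distrib-*)

  -- The sum telescopes: splitting off its first term and pulling `u` out of the rest reduces
  -- `suc N` to `N`, leaving `f + u`. The remainder `u ^ N` stays on the left so that no subtraction
  -- occurs and the semiring solver applies.
  geometric-sum : ∀ f u → f + u ≈ 1# → ∀ N →
                  f * sum {N} (λ m → u ^ toℕ m) + u ^ N ≈ 1#
  geometric-sum f u f+u≈1 zero    = trans (+-congʳ (zeroʳ f)) (+-identityˡ 1#)
  geometric-sum f u f+u≈1 (suc N) = begin
    f * (1# + sum {N} (λ m → u * u ^ toℕ m)) + u * u ^ N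
      ≈⟨ +-congʳ (*-congˡ (+-congˡ (*-distribˡ-sum {N} u (λ m → u ^ toℕ m)))) ⟨
    f * (1# + u * sum {N} (λ m → u ^ toℕ m)) + u * u ^ N
      ≈⟨ solve 4 (λ f u s v → f :* (con 1 :+ u :* s) :+ u :* v := f :+ u :* (f :* s :+ v))
           refl f u _ _ ⟩
    f + u * (f * sum {N} (λ m → u ^ toℕ m) + u ^ N)
      ≈⟨ +-congˡ (trans (*-congˡ (geometric-sum f u f+u≈1 N)) (*-identityʳ u)) ⟩
    f + u ≈⟨ f+u≈1 ⟩
    1#    ∎

  -- With j = s + m, the factor E^(2j) splits as (E^2)^s E^(2m), and (E^2)^s cancels the s copies of
  -- `D⁻¹`. Only the inverse property of `D⁻¹` enters, not its construction.
  clear-denominator : ∀ E D⁻¹ → E ^ 2 * D⁻¹ ≈ 1# → ∀ a x N m s →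
    E ^ (2 ℕ.* (s ℕ.+ m)) * (a * ((x * N) * D⁻¹) ^ s) ≈ (a * x ^ s) * (E ^ (2 ℕ.* m) * N ^ s)
  clear-denominator E D⁻¹ E²D⁻¹≈1 a x N m s = begin
    E ^ (2 ℕ.* (s ℕ.+ m)) * (a * ((x * N) * D⁻¹) ^ s)
      ≈⟨ *-cong split (*-congˡ (trans (^-distrib-* (x * N) D⁻¹ s) (*-congʳ (^-distrib-* x N s)))) ⟩
    ((E ^ 2) ^ s * E ^ (2 ℕ.* m)) * (a * ((x ^ s * N ^ s) * D⁻¹ ^ s))
      ≈⟨ solve 6 (λ e f a x n d → (e :* f) :* (a :* ((x :* n) :* d)) := (e :* d) :* ((a :* x) :* (f :* n)))
           refl _ _ a _ _ _ ⟩
    ((E ^ 2) ^ s * D⁻¹ ^ s) * ((a * x ^ s) * (E ^ (2 ℕ.* m) * N ^ s))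
      ≈⟨ *-congʳ (trans (sym (^-distrib-* (E ^ 2) D⁻¹ s)) (trans (^-congˡ s E²D⁻¹≈1) (1^n≈1 s))) ⟩
    1# * ((a * x ^ s) * (E ^ (2 ℕ.* m) * N ^ s))
      ≈⟨ *-identityˡ _ ⟩
    (a * x ^ s) * (E ^ (2 ℕ.* m) * N ^ s) ∎
    where
    1^n≈1 : ∀ n → 1# ^ n ≈ 1#
    1^n≈1 zero    = refl
    1^n≈1 (suc n) = trans (*-identityˡ _) (1^n≈1 n)

    split : E ^ (2 ℕ.* (s ℕ.+ m)) ≈ (E ^ 2) ^ s * E ^ (2 ℕ.* m)
    split = begin
      E ^ (2 ℕ.* (s ℕ.+ m))         ≈⟨ ^-congʳ E (ℕ.*-distribˡ-+ 2 s m) ⟩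
      E ^ (2 ℕ.* s ℕ.+ 2 ℕ.* m)     ≈⟨ ^-homo-* E (2 ℕ.* s) (2 ℕ.* m) ⟩
      E ^ (2 ℕ.* s) * E ^ (2 ℕ.* m) ≈⟨ *-congʳ (^-assocʳ E 2 s) ⟨
      (E ^ 2) ^ s * E ^ (2 ℕ.* m)   ∎

-- Formal power series form a commutative ring.

module SeriesRing (R : CommutativeRing c ℓ) where
  open CommutativeRing R
  open import Relation.Binary.Reasoning.Setoid setoid
  open SemiringSolver commutativeSemiring using (solve; _:=_; _:+_; _:*_; con)
  private module S = RawRing (R⟦X⟧ rawRing)
  open S using () renaming (_*_ to _⊛_; _≈_ to _≋_)

  -- (f ⊛ g) (suc n) unfolds to f 0 * g (suc n) + (tail f ⊛ g) n, so identities
  -- between Cauchy products follow by induction on the degree.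
  tail : (ℕ → Carrier) → ℕ → Carrier
  tail f = f ∘ suc

  -- Degree `n` of a product sees the second factor only up to degree `n`. The bound is what allows
  -- a series to be replaced by another that agrees with it in low degrees.
  ⊛-cong-≤ : ∀ {f f′ g g′} n → (∀ i → f i ≈ f′ i) → (∀ i → i ℕ.≤ n → g i ≈ g′ i) →
             (f ⊛ g) n ≈ (f′ ⊛ g′) n
  ⊛-cong-≤ zero    p q = +-congʳ (*-cong (p 0) (q 0 z≤n))
  ⊛-cong-≤ (suc n) p q = +-cong (*-cong (p 0) (q (suc n) ℕ.≤-refl))
    (⊛-cong-≤ n (p ∘ suc) (λ i i≤n → q i (ℕ.m≤n⇒m≤1+n i≤n)))

  ⊛-cong : ∀ {f f′ g g′} → f ≋ f′ → g ≋ g′ → f ⊛ g ≋ f′ ⊛ g′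
  ⊛-cong p q n = ⊛-cong-≤ n p (λ i _ → q i)

  ⊛-congʳ : ∀ {f f′} g → f ≋ f′ → f ⊛ g ≋ f′ ⊛ g
  ⊛-congʳ g p = ⊛-cong {g = g} p (λ _ → refl)

  -- The Cauchy product unfolds at the constant coefficient of its left factor. Peeling off the
  -- opposite end gives the mirrored recursion that commutativity needs.
  ⊛-suc-last : ∀ f g n → (f ⊛ g) (suc n) ≈ f (suc n) * g 0 + (f ⊛ tail g) n
  ⊛-suc-last f g zero    =
    solve 4 (λ f₀ f₁ g₀ g₁ → f₀ :* g₁ :+ (f₁ :* g₀ :+ con 0) := f₁ :* g₀ :+ (f₀ :* g₁ :+ con 0))
      refl (f 0) (f 1) (g 0) (g 1)
  ⊛-suc-last f g (suc n) = begin
    f 0 * g (2 ℕ.+ n) + (tail f ⊛ g) (suc n)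
      ≈⟨ +-congˡ (⊛-suc-last (tail f) g n) ⟩
    f 0 * g (2 ℕ.+ n) + (f (2 ℕ.+ n) * g 0 + (tail f ⊛ tail g) n)
      ≈⟨ solve 3 (λ a b d → a :+ (b :+ d) := b :+ (a :+ d)) refl _ _ _ ⟩
    f (2 ℕ.+ n) * g 0 + (f ⊛ tail g) (suc n) ∎

  ⊛-comm : ∀ f g → f ⊛ g ≋ g ⊛ f
  ⊛-comm f g zero    = +-congʳ (*-comm (f 0) (g 0))
  ⊛-comm f g (suc n) = begin
    f 0 * g (suc n) + (tail f ⊛ g) n ≈⟨ +-cong (*-comm _ _) (⊛-comm (tail f) g n) ⟩
    g (suc n) * f 0 + (g ⊛ tail f) n ≈⟨ ⊛-suc-last g f n ⟨
    (g ⊛ f) (suc n)                  ∎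

  ⊛-scale : ∀ a f g n → ((λ i → a * f i) ⊛ g) n ≈ a * (f ⊛ g) n
  ⊛-scale a f g zero    =
    solve 3 (λ a x y → (a :* x) :* y :+ con 0 := a :* (x :* y :+ con 0)) refl a (f 0) (g 0)
  ⊛-scale a f g (suc n) = begin
    (a * f 0) * g (suc n) + ((λ i → a * tail f i) ⊛ g) n ≈⟨ +-congˡ (⊛-scale a (tail f) g n) ⟩
    (a * f 0) * g (suc n) + a * (tail f ⊛ g) n
      ≈⟨ solve 4 (λ a x y z → (a :* x) :* y :+ a :* z := a :* (x :* y :+ z)) refl a _ _ _ ⟩
    a * (f ⊛ g) (suc n) ∎

  ⊛-zeroˡ : ∀ f n → (S.0# ⊛ f) n ≈ 0#
  ⊛-zeroˡ f zero    = solve 1 (λ x → con 0 :* x :+ con 0 := con 0) refl (f 0)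
  ⊛-zeroˡ f (suc n) = trans (+-cong (zeroˡ _) (⊛-zeroˡ f n)) (+-identityˡ 0#)

  ⊛-identityˡ : ∀ f → S.1# ⊛ f ≋ f
  ⊛-identityˡ f zero    = trans (+-identityʳ _) (*-identityˡ _)
  ⊛-identityˡ f (suc n) = trans (+-cong (*-identityˡ _) (⊛-zeroˡ f n)) (+-identityʳ _)

  ⊛-distribʳ : ∀ h f g → (f S.+ g) ⊛ h ≋ f ⊛ h S.+ g ⊛ h
  ⊛-distribʳ h f g zero    =
    solve 3 (λ x y z → (x :+ y) :* z :+ con 0 := (x :* z :+ con 0) :+ (y :* z :+ con 0))
      refl (f 0) (g 0) (h 0)
  ⊛-distribʳ h f g (suc n) = trans (+-congˡ (⊛-distribʳ h (tail f) (tail g) n))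
    (solve 5 (λ x y z u v → (x :+ y) :* z :+ (u :+ v) := (x :* z :+ u) :+ (y :* z :+ v)) refl
      (f 0) (g 0) _ _ _)

  ⊛-assoc : ∀ f g h → (f ⊛ g) ⊛ h ≋ f ⊛ (g ⊛ h)
  ⊛-assoc f g h zero    =
    solve 3 (λ x y z → (x :* y :+ con 0) :* z :+ con 0 := x :* (y :* z :+ con 0) :+ con 0) refl
      (f 0) (g 0) (h 0)
  ⊛-assoc f g h (suc n) = begin
    (f ⊛ g) 0 * h (suc n) + (tail (f ⊛ g) ⊛ h) n
      -- By computation, `tail (f ⊛ g)` is the sum of the `f 0`-multiple of `tail g` and
      -- `tail f ⊛ g`, so the induction continues with `tail f`.
      ≈⟨ +-congˡ (⊛-distribʳ h (λ i → f 0 * tail g i) (tail f ⊛ g) n) ⟩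
    (f ⊛ g) 0 * h (suc n) + (((λ i → f 0 * tail g i) ⊛ h) n + ((tail f ⊛ g) ⊛ h) n)
      ≈⟨ +-congˡ (+-cong (⊛-scale (f 0) (tail g) h n) (⊛-assoc (tail f) g h n)) ⟩
    (f 0 * g 0 + 0#) * h (suc n) + (f 0 * (tail g ⊛ h) n + (tail f ⊛ (g ⊛ h)) n)
      ≈⟨ solve 5 (λ x y z u v → (x :* y :+ con 0) :* z :+ (x :* u :+ v) := x :* (y :* z :+ u) :+ v)
           refl (f 0) (g 0) _ _ _ ⟩
    f 0 * (g ⊛ h) (suc n) + (tail f ⊛ (g ⊛ h)) n ∎

  R⟦X⟧-isCommutativeRing : IsCommutativeRing _≋_ S._+_ _⊛_ S.-_ S.0# S.1#
  R⟦X⟧-isCommutativeRing = record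
    { isRing = record
      { +-isAbelianGroup = Pointwise.isAbelianGroup ℕ +-isAbelianGroup
      ; *-cong           = ⊛-cong
      ; *-assoc          = ⊛-assoc
      ; *-identity       = ⊛-identityˡ , λ f n → trans (⊛-comm f S.1# n) (⊛-identityˡ f n)
      ; distrib          =
          (λ f g h n → begin
            (f ⊛ (g S.+ h)) n         ≈⟨ ⊛-comm f (g S.+ h) n ⟩
            ((g S.+ h) ⊛ f) n         ≈⟨ ⊛-distribʳ f g h n ⟩
            (g ⊛ f) n + (h ⊛ f) n     ≈⟨ +-cong (⊛-comm g f n) (⊛-comm h f n) ⟩
            (f ⊛ g) n + (f ⊛ h) n     ∎)
          , ⊛-distribʳ
      }
    ; *-comm = ⊛-comm
    }

  R⟦X⟧-commutativeRing : CommutativeRing _ _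
  R⟦X⟧-commutativeRing = record { isCommutativeRing = R⟦X⟧-isCommutativeRing }

-- Coefficients, inverses and powers of power series.

module SeriesProperties (R : CommutativeRing c ℓ) where
  open CommutativeRing R
  open SeriesRing R using (R⟦X⟧-commutativeRing; tail; ⊛-cong-≤; ⊛-zeroˡ; ⊛-identityˡ; ⊛-congʳ)
  open import Relation.Binary.Reasoning.Setoid setoid
  open SemiringSolver commutativeSemiring using (solve; _:=_; _:+_; _:*_; con)
  open SemiringSum semiring using (sum; sum-cong-≋; sum-replicate-zero)
  open SemiringMult semiring using () renaming (_×_ to _·_)
  open SemiringExp semiring using () renaming (_^_ to _^ᴿ_)
  open PowerSeries rawRing using (const; X; _⁻¹; _^_) renaming (sum to sumˢ)
  open RingIdentities R⟦X⟧-commutativeRing using (geometric-sum)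
  private module S = CommutativeRing R⟦X⟧-commutativeRing

  sumˢ-coeff : ∀ {N} (F : Vector S.Carrier N) n → sumˢ F n ≈ sum (λ i → F i n)
  sumˢ-coeff {zero}  F n = refl
  sumˢ-coeff {suc N} F n = +-congˡ (sumˢ-coeff (F ∘ Fin.suc) n)

  const-*-coeff : ∀ a f n → (const a S.* f) n ≈ a * f n
  const-*-coeff a f zero    = +-identityʳ _
  const-*-coeff a f (suc n) = trans (+-congˡ (⊛-zeroˡ f n)) (+-identityʳ _)

  const-* : ∀ a b → const a S.* const b S.≈ const (a * b)
  const-* a b zero    = +-identityʳ _
  const-* a b (suc n) = trans (const-*-coeff a (const b) (suc n)) (zeroʳ a)

  const-1 : const 1# S.≈ S.1#
  const-1 zero    = refl
  const-1 (suc n) = refl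

  const-^ : ∀ a n → const a ^ n S.≈ const (a ^ᴿ n)
  const-^ a zero    = S.sym const-1
  const-^ a (suc n) = S.trans (S.*-congˡ {const a} (const-^ a n)) (const-* a (a ^ᴿ n))

  X-*-zero : ∀ f → (X S.* f) 0 ≈ 0#
  X-*-zero f = trans (+-identityʳ _) (zeroˡ _)

  X-*-suc : ∀ f n → (X S.* f) (suc n) ≈ f n
  X-*-suc f n = begin
    0# * f (suc n) + (tail X S.* f) n ≈⟨ +-cong (zeroˡ _) (⊛-congʳ f tail-X n) ⟩
    0# + (S.1# S.* f) n               ≈⟨ +-identityˡ _ ⟩
    (S.1# S.* f) n                    ≈⟨ ⊛-identityˡ f n ⟩
    f n                               ∎
    where
    tail-X : tail X S.≈ S.1#
    tail-X zero    = refl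
    tail-X (suc n) = refl

  sum-truncate : ∀ {M N} (t : ℕ → Carrier) → M ℕ.≤ N → (∀ m → M ℕ.≤ m → t m ≈ 0#) →
                 sum {N} (t ∘ toℕ) ≈ sum {M} (t ∘ toℕ)
  sum-truncate {zero}  {N}     t _         t≈0 =
    trans (sum-cong-≋ {N} (λ i → t≈0 (toℕ i) z≤n)) (sum-replicate-zero N)
  sum-truncate {suc M} {suc N} t (s≤s M≤N) t≈0 =
    +-congˡ (sum-truncate {M} {N} (t ∘ suc) M≤N (λ m M≤m → t≈0 (suc m) (s≤s M≤m)))

  -- Each factor `u` lacks a constant term, so it raises the order of the product by at least one.
  ^-low-degree : ∀ u → u 0 ≈ 0# → ∀ m n → n ℕ.< m → (u ^ m) n ≈ 0#
  ^-low-degree u u₀≈0 (suc m) zero    _         =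
    trans (+-identityʳ _) (trans (*-congʳ u₀≈0) (zeroˡ _))
  ^-low-degree u u₀≈0 (suc m) (suc n) (s≤s n<m) = begin
    u 0 * (u ^ m) (suc n) + (tail u S.* u ^ m) n
      ≈⟨ +-cong (trans (*-congʳ u₀≈0) (zeroˡ _))
           (⊛-cong-≤ {f = tail u} {g′ = S.0#} n (λ _ → refl)
             (λ i i≤n → ^-low-degree u u₀≈0 m i (ℕ.≤-<-trans i≤n n<m))) ⟩
    0# + (tail u S.* S.0#) n ≈⟨ +-identityˡ _ ⟩
    (tail u S.* S.0#) n      ≈⟨ S.zeroʳ (tail u) n ⟩
    0#                       ∎

  -- `f ⁻¹` sums a different number of terms in each degree. Up to degree `n` it agrees with the
  -- single finite sum `partial (suc n)`, for which `geometric-sum` leaves the remainder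
  -- `u ^ suc n`, and this vanishes in degree `n`.
  ⁻¹-inverseʳ : ∀ f → f 0 ≈ 1# → f S.* f ⁻¹ S.≈ S.1#
  ⁻¹-inverseʳ f f₀≈1 n = begin
    (f S.* f ⁻¹) n
      ≈⟨ ⊛-cong-≤ {f = f} {g′ = partial (suc n)} n (λ _ → refl) (λ i i≤n → sym (partial-stable i≤n)) ⟩
    (f S.* partial (suc n)) n
      ≈⟨ +-identityʳ _ ⟨
    (f S.* partial (suc n)) n + 0#
      ≈⟨ +-congˡ (^-low-degree u u₀≈0 (suc n) n ℕ.≤-refl) ⟨
    (f S.* partial (suc n)) n + (u ^ suc n) n
      ≈⟨ geometric-sum f u f+u≈1 (suc n) n ⟩
    S.1# n ∎
    where
    u : S.Carrier
    u = S.1# S.+ S.- f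

    partial : ℕ → S.Carrier
    partial N = sumˢ {N} (λ m → u ^ toℕ m)

    u₀≈0 : u 0 ≈ 0#
    u₀≈0 = trans (+-congˡ (-‿cong f₀≈1)) (-‿inverseʳ 1#)

    f+u≈1 : f S.+ u S.≈ S.1#
    f+u≈1 n = begin
      f n + (S.1# n - f n) ≈⟨ solve 3 (λ a b d → a :+ (b :+ d) := b :+ (a :+ d)) refl _ _ _ ⟩
      S.1# n + (f n - f n) ≈⟨ +-congˡ (-‿inverseʳ (f n)) ⟩
      S.1# n + 0#          ≈⟨ +-identityʳ _ ⟩
      S.1# n               ∎

    partial-stable : ∀ {i n} → i ℕ.≤ n → partial (suc n) i ≈ partial (suc i) i
    partial-stable {i} {n} i≤n = begin
      partial (suc n) i                       ≈⟨ sumˢ-coeff {suc n} (λ m → u ^ toℕ m) i ⟩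
      sum {suc n} (λ m → (u ^ toℕ m) i)       ≈⟨ sum-truncate {suc i} {suc n} (λ m → (u ^ m) i) (s≤s i≤n) (λ m → ^-low-degree u u₀≈0 m i) ⟩
      sum {suc i} (λ m → (u ^ toℕ m) i)       ≈⟨ sumˢ-coeff {suc i} (λ m → u ^ toℕ m) i ⟨
      partial (suc i) i                       ∎

  ^-coeff₀ : ∀ f → f 0 ≈ 1# → ∀ n → (f ^ n) 0 ≈ 1#
  ^-coeff₀ f f₀≈1 zero    = refl
  ^-coeff₀ f f₀≈1 (suc n) = begin
    f 0 * (f ^ n) 0 + 0# ≈⟨ +-identityʳ _ ⟩
    f 0 * (f ^ n) 0      ≈⟨ *-cong f₀≈1 (^-coeff₀ f f₀≈1 n) ⟩
    1# * 1#              ≈⟨ *-identityˡ 1# ⟩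
    1#                   ∎

  ^-coeff₁ : ∀ f → f 0 ≈ 1# → ∀ n → (f ^ n) 1 ≈ n · f 1
  ^-coeff₁ f f₀≈1 zero    = refl
  ^-coeff₁ f f₀≈1 (suc n) = begin
    f 0 * (f ^ n) 1 + (f 1 * (f ^ n) 0 + 0#)
      ≈⟨ +-cong (*-cong f₀≈1 (^-coeff₁ f f₀≈1 n)) (+-congʳ (*-congˡ (^-coeff₀ f f₀≈1 n))) ⟩
    1# * (n · f 1) + (f 1 * 1# + 0#)
      ≈⟨ solve 2 (λ x y → con 1 :* y :+ (x :* con 1 :+ con 0) := x :+ y) refl _ _ ⟩
    f 1 + n · f 1 ∎

  -- Degree two arises either from one factor, in `n` ways, or from two factors of degree one, in
  -- `n C 2` ways.
  ^-coeff₂ : ∀ f → f 0 ≈ 1# → ∀ n → (f ^ n) 2 ≈ n · f 2 + (n C 2) · (f 1 * f 1)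
  ^-coeff₂ f f₀≈1 zero    = sym (+-identityˡ 0#)
  ^-coeff₂ f f₀≈1 (suc n) = begin
    f 0 * (f ^ n) 2 + (f 1 * (f ^ n) 1 + (f 2 * (f ^ n) 0 + 0#))
      ≈⟨ +-cong (*-cong f₀≈1 (^-coeff₂ f f₀≈1 n))
           (+-cong (trans (*-congˡ (^-coeff₁ f f₀≈1 n)) (×-comm-* n _ _))
             (+-congʳ (*-congˡ (^-coeff₀ f f₀≈1 n)))) ⟩
    1# * (n · f 2 + (n C 2) · (f 1 * f 1)) + (n · (f 1 * f 1) + (f 2 * 1# + 0#))
      ≈⟨ solve 4 (λ a b d e → con 1 :* (a :+ b) :+ (d :+ (e :* con 1 :+ con 0)) := (e :+ a) :+ (d :+ b))
           refl _ _ _ _ ⟩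
    suc n · f 2 + (n · (f 1 * f 1) + (n C 2) · (f 1 * f 1))
      ≈⟨ +-congˡ (×-homo-+ _ n (n C 2)) ⟨
    suc n · f 2 + (n ℕ.+ n C 2) · (f 1 * f 1)
      -- Pascal's rule, with `n` read as `n C 1`.
      ≡⟨ ≡.cong (λ k → suc n · f 2 + k · (f 1 * f 1))
           (≡.trans (≡.cong (ℕ._+ n C 2) (≡.sym (nC1≡n n))) (nCk+nC[k+1]≡[n+1]C[k+1] n 1)) ⟩
    suc n · f 2 + (suc n C 2) · (f 1 * f 1) ∎
    where open SemiringMult semiring using (×-comm-*; ×-homo-+)

-- The generating function over an arbitrary raw ring of coefficients.

module GeneratingFunction (Q : RawRing c ℓ) (x : RawRing.Carrier Q) where
  private module Q = RingOps Q
  open PowerSeries Q using (Carrier; _+_; _*_; 1#; const; X; _^_; _/_; _·_; sum)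

  E N quotient : Carrier
  E        = 1# + 4 · (const x * X)
  N        = 1# + 2 · X + 4 · (const x * X ^ 2)
  quotient = (const x * N) / E ^ 2

  term : ℕ → Q.Carrier → ℕ → Carrier
  term j a s = E ^ (2 ℕ.* j) * (const a * quotient ^ s)

  series : ∀ {n} → ℕ → Vector Q.Carrier n → Carrier
  series j a = E ^ (2 ℕ.* j) * sum (λ s → const (a s) * quotient ^ toℕ s)

  -- The product of y with the W²-coefficient of E ^ n * N ^ s.
  combination : ℕ → ℕ → Q.Carrier → Q.Carrier
  combination n s y =
    4 Q.· ((s C 2) Q.· y) Q.+ (4 Q.· (s Q.· (x Q.* y)) Q.+ 8 Q.· (n Q.· (s Q.· (x Q.* y))))
      Q.+ 16 Q.· ((n C 2) Q.· (x Q.* (x Q.* y)))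

  -- The exponent `2 ℕ.* (j ℕ.∸ toℕ s)` is what remains on `E` after cancellation; the truncated
  -- subtraction is exact for `toℕ s` at most `j`.
  coefficient₂ : ∀ {n} → ℕ → Vector Q.Carrier n → Q.Carrier
  coefficient₂ j a =
    Q.sum (λ s → combination (2 ℕ.* (j ℕ.∸ toℕ s)) (toℕ s) (a s Q.* x Q.^ toℕ s))

  private
    sum-cong : ∀ {n} {f g : Vector Carrier n} → (∀ i → f i ≡ g i) → sum f ≡ sum g
    sum-cong {zero}  f≡g = ≡.refl
    sum-cong {suc n} f≡g = ≡.cong₂ _+_ (f≡g Fin.zero) (sum-cong (f≡g ∘ Fin.suc))

  -- Separate hypotheses for the outer shape, `E′` and each `T i` let large terms be compared piece
  -- by piece. The summand at exponent 0 stands apart because `quotient ^ 0` reduces to `1#`.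
  recognise-series : ∀ {n} j (a : Vector Q.Carrier (suc n)) {f E′} {T : Vector Carrier n} →
    f ≡ E′ ^ (2 ℕ.* j) * (const (a Fin.zero) * 1# + sum T) → E′ ≡ E →
    (∀ i → T i ≡ const (a (Fin.suc i)) * quotient ^ suc (toℕ i)) → f ≡ series j a
  recognise-series j a ≡.refl ≡.refl T≡ =
    ≡.cong (λ t → E ^ (2 ℕ.* j) * (const (a Fin.zero) * 1# + t)) (sum-cong T≡)

-- The W^2-coefficient of the generating function.

module GeneratingFunctionCoefficient (R : CommutativeRing c ℓ) (x : CommutativeRing.Carrier R) where
  open CommutativeRing R
  open SeriesProperties R
  open RingIdentities (SeriesRing.R⟦X⟧-commutativeRing R) using (clear-denominator)
  open import Relation.Binary.Reasoning.Setoid setoid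
  open SemiringSolver commutativeSemiring using (Polynomial; solve; _:=_; _:+_; _:*_; con)
  open SemiringSum semiring using (sum; sum-cong-≋)
  open SemiringMult semiring using (×-congʳ; ×-assoc-*) renaming (_×_ to _·_)
  open SemiringExp semiring using () renaming (_^_ to _^ᴿ_)
  private
    module S = CommutativeRing (SeriesRing.R⟦X⟧-commutativeRing R)
    open PowerSeries rawRing using (const; X; _^_; _⁻¹) renaming (sum to sumˢ)
  open GeneratingFunction rawRing x

  private
    4·0≈0 : ∀ {z} → z ≈ 0# → 4 · z ≈ 0#
    4·0≈0 z≈0 = trans (×-congʳ 4 z≈0) (trans (+-identityˡ _) (trans (+-identityˡ _)
      (trans (+-identityˡ _) (+-identityˡ _))))

    const-*-coeff-0 : ∀ f n → f n ≈ 0# → (const x S.* f) n ≈ 0#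
    const-*-coeff-0 f n fₙ≈0 = trans (const-*-coeff x f n) (trans (*-congˡ fₙ≈0) (zeroʳ x))

    const-*-coeff-1 : ∀ f n → f n ≈ 1# → (const x S.* f) n ≈ x
    const-*-coeff-1 f n fₙ≈1 = trans (const-*-coeff x f n) (trans (*-congˡ fₙ≈1) (*-identityʳ x))

    X²₀ : (X ^ 2) 0 ≈ 0#
    X²₀ = X-*-zero (X ^ 1)

    X²₁ : (X ^ 2) 1 ≈ 0#
    X²₁ = trans (X-*-suc (X ^ 1) 0) (X-*-zero S.1#)

    X²₂ : (X ^ 2) 2 ≈ 1#
    X²₂ = trans (X-*-suc (X ^ 1) 1) (X-*-suc S.1# 0)

  E₀ : E 0 ≈ 1#
  E₀ = trans (+-congˡ (4·0≈0 (const-*-coeff-0 X 0 refl))) (+-identityʳ 1#)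

  E₁ : E 1 ≈ 4 · x
  E₁ = trans (+-identityˡ _) (×-congʳ 4 (const-*-coeff-1 X 1 refl))

  E₂ : E 2 ≈ 0#
  E₂ = trans (+-identityˡ _) (4·0≈0 (const-*-coeff-0 X 2 refl))

  N₀ : N 0 ≈ 1#
  N₀ = trans (+-cong (solve 0 (con 1 :+ (con 0 :+ (con 0 :+ con 0)) := con 1) refl)
    (4·0≈0 (const-*-coeff-0 (X ^ 2) 0 X²₀))) (+-identityʳ 1#)

  N₁ : N 1 ≈ 2 · 1#
  N₁ = trans (+-cong (+-identityˡ (2 · 1#)) (4·0≈0 (const-*-coeff-0 (X ^ 2) 1 X²₁)))
    (+-identityʳ (2 · 1#))

  N₂ : N 2 ≈ 4 · x
  N₂ = trans (+-cong (solve 0 (con 0 :+ (con 0 :+ (con 0 :+ con 0)) := con 0) refl)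
    (×-congʳ 4 (const-*-coeff-1 (X ^ 2) 2 X²₂))) (+-identityˡ (4 · x))

  -- The degrees of the two factors split as 0+2, 1+1 or 2+0. As `E` has no W^2 term, `E ^ n`
  -- reaches degree 2 only through pairs of factors, whereas `N ^ s` reaches it also through a
  -- single 4xW^2.
  EⁿNˢ-coeff₂ : ∀ y n s → y * (E ^ n S.* N ^ s) 2 ≈ combination n s y
  EⁿNˢ-coeff₂ y n s = begin
    y * ((E ^ n) 0 * (N ^ s) 2 + ((E ^ n) 1 * (N ^ s) 1 + ((E ^ n) 2 * (N ^ s) 0 + 0#)))
      ≈⟨ *-congˡ (+-cong (*-cong (^-coeff₀ E E₀ n) Nˢ₂)
           (+-cong (*-cong Eⁿ₁ Nˢ₁) (+-congʳ (*-cong Eⁿ₂ (^-coeff₀ N N₀ s))))) ⟩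
    y * (1# * ((s · 1#) * (4 · x) + ((s C 2) · 1#) * ((2 · 1#) * (2 · 1#)))
      + (((n · 1#) * (4 · x)) * ((s · 1#) * (2 · 1#))
      + (((n C 2) · 1#) * ((4 · x) * (4 · x)) * 1# + 0#)))
      -- Multiples by `s`, `n` and the binomials appear as `_ · 1#`, so that they can be variables
      -- of the solver; `scalar` turns them back afterwards.
      ≈⟨ solve 6 (λ x y s s₂ n n₂ →
           y :* (con 1 :* (s :* (4 :· x) :+ s₂ :* ((2 :· con 1) :* (2 :· con 1)))
             :+ ((n :* (4 :· x)) :* (s :* (2 :· con 1))
             :+ (n₂ :* ((4 :· x) :* (4 :· x)) :* con 1 :+ con 0)))
           := 4 :· (s₂ :* y) :+ ((4 :· (s :* (x :* y))) :+ (8 :· (n :* (s :* (x :* y)))))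
             :+ 16 :· (n₂ :* (x :* (x :* y))))
           refl x y (s · 1#) ((s C 2) · 1#) (n · 1#) ((n C 2) · 1#) ⟩
    4 · (((s C 2) · 1#) * y)
      + (4 · ((s · 1#) * (x * y)) + 8 · ((n · 1#) * ((s · 1#) * (x * y))))
      + 16 · (((n C 2) · 1#) * (x * (x * y)))
      ≈⟨ +-cong (+-cong (×-congʳ 4 (scalar (s C 2) y))
           (+-cong (×-congʳ 4 (scalar s (x * y)))
             (×-congʳ 8 (trans (*-congˡ (scalar s (x * y))) (scalar n (s · (x * y)))))))
           (×-congʳ 16 (scalar (n C 2) (x * (x * y)))) ⟩
    combination n s y ∎
    where
    infixr 9 _:·_
    _:·_ : ∀ {k} → ℕ → Polynomial k → Polynomial k
    zero  :· p = con 0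
    suc n :· p = p :+ n :· p

    scalar : ∀ n z → (n · 1#) * z ≈ n · z
    scalar n z = trans (×-assoc-* n 1# z) (×-congʳ n (*-identityˡ z))

    Eⁿ₁ : (E ^ n) 1 ≈ (n · 1#) * (4 · x)
    Eⁿ₁ = trans (^-coeff₁ E E₀ n) (trans (×-congʳ n E₁) (sym (scalar n (4 · x))))

    Nˢ₁ : (N ^ s) 1 ≈ (s · 1#) * (2 · 1#)
    Nˢ₁ = trans (^-coeff₁ N N₀ s) (trans (×-congʳ s N₁) (sym (scalar s (2 · 1#))))

    Eⁿ₂ : (E ^ n) 2 ≈ ((n C 2) · 1#) * ((4 · x) * (4 · x))
    Eⁿ₂ = begin
      (E ^ n) 2                                 ≈⟨ ^-coeff₂ E E₀ n ⟩
      n · E 2 + (n C 2) · (E 1 * E 1)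
        ≈⟨ +-cong (trans (×-congʳ n E₂) (trans (sym (scalar n 0#)) (zeroʳ (n · 1#))))
             (×-congʳ (n C 2) (*-cong E₁ E₁)) ⟩
      0# + (n C 2) · ((4 · x) * (4 · x))        ≈⟨ +-identityˡ _ ⟩
      (n C 2) · ((4 · x) * (4 · x))             ≈⟨ scalar (n C 2) _ ⟨
      ((n C 2) · 1#) * ((4 · x) * (4 · x))      ∎

    Nˢ₂ : (N ^ s) 2 ≈ (s · 1#) * (4 · x) + ((s C 2) · 1#) * ((2 · 1#) * (2 · 1#))
    Nˢ₂ = begin
      (N ^ s) 2                                 ≈⟨ ^-coeff₂ N N₀ s ⟩
      s · N 2 + (s C 2) · (N 1 * N 1)
        ≈⟨ +-cong (×-congʳ s N₂) (×-congʳ (s C 2) (*-cong N₁ N₁)) ⟩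
      s · (4 · x) + (s C 2) · ((2 · 1#) * (2 · 1#))
        ≈⟨ +-cong (scalar s (4 · x)) (scalar (s C 2) _) ⟨
      (s · 1#) * (4 · x) + ((s C 2) · 1#) * ((2 · 1#) * (2 · 1#)) ∎

  -- Writing j as `s ℕ.+ m` avoids truncated subtraction. After cancellation, the factor a x^s is
  -- constant in W and passes through the extraction of the coefficient.
  term-coeff₂ : ∀ a m s → term (s ℕ.+ m) a s 2 ≈ combination (2 ℕ.* m) s (a * x ^ᴿ s)
  term-coeff₂ a m s = begin
    term (s ℕ.+ m) a s 2
      ≈⟨ clear-denominator E ((E ^ 2) ⁻¹) (⁻¹-inverseʳ (E ^ 2) (^-coeff₀ E E₀ 2))
           (const a) (const x) N m s 2 ⟩
    ((const a S.* const x ^ s) S.* (E ^ (2 ℕ.* m) S.* N ^ s)) 2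
      ≈⟨ S.*-congʳ {E ^ (2 ℕ.* m) S.* N ^ s} constant 2 ⟩
    (const (a * x ^ᴿ s) S.* (E ^ (2 ℕ.* m) S.* N ^ s)) 2
      ≈⟨ const-*-coeff (a * x ^ᴿ s) (E ^ (2 ℕ.* m) S.* N ^ s) 2 ⟩
    (a * x ^ᴿ s) * (E ^ (2 ℕ.* m) S.* N ^ s) 2
      ≈⟨ EⁿNˢ-coeff₂ (a * x ^ᴿ s) (2 ℕ.* m) s ⟩
    combination (2 ℕ.* m) s (a * x ^ᴿ s) ∎
    where
    constant : const a S.* const x ^ s S.≈ const (a * x ^ᴿ s)
    constant = S.trans (S.*-congˡ {const a} (const-^ x s)) (const-* a (x ^ᴿ s))

  series-coeff₂ : ∀ {n} j (a : Vector Carrier n) → n ℕ.≤ suc j →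
    series j a 2 ≈ coefficient₂ j a
  series-coeff₂ {n} j a n≤1+j = begin
    series j a 2
      ≈⟨ *-distribˡ-sum {n} (E ^ (2 ℕ.* j)) (λ s → const (a s) S.* quotient ^ toℕ s) 2 ⟩
    sumˢ {n} (λ s → term j (a s) (toℕ s)) 2
      ≈⟨ sumˢ-coeff {n} (λ s → term j (a s) (toℕ s)) 2 ⟩
    sum {n} (λ s → term j (a s) (toℕ s) 2)
      ≈⟨ sum-cong-≋ {n} summand ⟩
    sum {n} (λ s → combination (2 ℕ.* (j ℕ.∸ toℕ s)) (toℕ s) (a s * x ^ᴿ toℕ s)) ∎
    where
    open SemiringSum S.semiring using (*-distribˡ-sum)

    s≤j : (s : Fin n) → toℕ s ℕ.≤ j
    s≤j s = ℕ.≤-pred (ℕ.≤-trans (toℕ<n s) n≤1+j)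

    summand : (s : Fin n) →
      term j (a s) (toℕ s) 2 ≈ combination (2 ℕ.* (j ℕ.∸ toℕ s)) (toℕ s) (a s * x ^ᴿ toℕ s)
    -- Transport along s + (j ∸ s) = j, valid because the vector has length at most `suc j`.
    summand s = ≡.subst
      (λ i → term i (a s) (toℕ s) 2 ≈ combination (2 ℕ.* (j ℕ.∸ toℕ s)) (toℕ s) (a s * x ^ᴿ toℕ s))
      (ℕ.m+[n∸m]≡n (s≤j s)) (term-coeff₂ (a s) (j ℕ.∸ toℕ s) (toℕ s))

-- Taking Q equal to rawRing R by a hypothesis keeps the conversion between their
-- operations out of the nested Cauchy products, where it would be infeasible.
series-coeff₂-raw : (R : CommutativeRing c ℓ) (Q : RawRing c ℓ) → CommutativeRing.rawRing R ≡ Q →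
  (x : RawRing.Carrier Q) (j : ℕ) (a : Vector (RawRing.Carrier Q) (suc j)) →
  let open GeneratingFunction Q x in RawRing._≈_ Q (series j a 2) (coefficient₂ j a)
series-coeff₂-raw R _ ≡.refl x j a = GeneratingFunctionCoefficient.series-coeff₂ R x j a ℕ.≤-refl

-- Identification of the defined generating function with the general series.

module _ (j : ℕ) (P : Vector ℤ (suc j)) where
  open PowerSeries (R⟦X⟧ ℤʳ)
  private
    module ℤ⟦x⟧ = PowerSeries ℤʳ
    module G = GeneratingFunction (R⟦X⟧ ℤʳ) ℤ⟦x⟧.X

    -- generatingFunction j P and G.series are definitionally equal, but deciding
    -- this in one go takes exponential time. The underscores recover the subterms
    -- of generatingFunction itself, which are then compared one at a time.
    decomposition : Σ Carrier λ E → Σ (Vector Carrier j) λ T →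
      generatingFunction j P ≡ E ^ (2 ℕ.* j) * (const (ℤ⟦x⟧.const (P Fin.zero)) * 1# + sum T)
    decomposition = _ , _ , ≡.refl

    T : Vector Carrier j
    T = proj₁ (proj₂ decomposition)

    module _ (i : Fin j) where
      -- In this coefficient everything except u ^ toℕ i evaluates, so that
      -- unification finds u.
      quotientOf : Σ Carrier λ u →
        T i 0 1 ≡ (const (ℤ⟦x⟧.const (P (Fin.suc i))) * (G.quotient * u ^ toℕ i)) 0 1
      quotientOf = _ , ≡.refl

      quotientOf≡ : proj₁ quotientOf ≡ G.quotient
      quotientOf≡ = ≡.refl

      T≡power : T i ≡ const (ℤ⟦x⟧.const (P (Fin.suc i))) * proj₁ quotientOf ^ suc (toℕ i)
      T≡power = ≡.refl

  generatingFunction≡series : generatingFunction j P ≡ G.series j (ℤ⟦x⟧.const ∘ P)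
  generatingFunction≡series = G.recognise-series j (ℤ⟦x⟧.const ∘ P)
    (proj₂ (proj₂ decomposition)) ≡.refl
    (λ i → ≡.trans (T≡power i)
      (≡.cong (λ u → const (ℤ⟦x⟧.const (P (Fin.suc i))) * u ^ suc (toℕ i)) (quotientOf≡ i)))

-- Coefficients of x^k over the integers.

open import Data.Integer using (_+_; _-_; _*_)
open import Data.Integer.Tactic.RingSolver using (solve-∀)
open PowerSeries ℤʳ using (const; _^_; _·_) renaming (X to x; _*_ to _⊛_)
open SemiringSum ℤ.+-*-semiring using (sum; sum-cong-≗; ∑-distrib-+)
open GeneratingFunction (R⟦X⟧ ℤʳ) x using (series; combination; coefficient₂)

private
  module ℤₚ = SeriesProperties ℤ.+-*-commutativeRing

-- Doubling avoids division. Pascal's rule turns the induction step into 2n + n(n-1) = (n+1)n.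
2*nC2 : ∀ n → + 2 * + (n C 2) ≡ + n * (+ n - + 1)
2*nC2 zero    = ≡.refl
2*nC2 (suc n) = begin
  + 2 * + (suc n C 2)         ≡⟨ ≡.cong (λ k → + 2 * + k) (nCk+nC[k+1]≡[n+1]C[k+1] n 1) ⟨
  + 2 * + (n C 1 ℕ.+ n C 2)   ≡⟨ ≡.cong (λ k → + 2 * + (k ℕ.+ n C 2)) (nC1≡n n) ⟩
  + 2 * (+ n + + (n C 2))     ≡⟨ ℤ.*-distribˡ-+ (+ 2) (+ n) (+ (n C 2)) ⟩
  + 2 * + n + + 2 * + (n C 2) ≡⟨ ≡.cong (_+_ (+ 2 * + n)) (2*nC2 n) ⟩
  + 2 * + n + + n * (+ n - + 1) ≡⟨ regroup (+ n) ⟩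
  + suc n * (+ suc n - + 1)   ∎
  where
  open ≡.≡-Reasoning
  regroup : ∀ n → + 2 * n + n * (n - + 1) ≡ (+ 1 + n) * ((+ 1 + n) - + 1)
  regroup = solve-∀

·-coeff : ∀ n (f : ℕ → ℤ) k → (n · f) k ≡ + n * f k
·-coeff zero    f k = ≡.refl
·-coeff (suc n) f k = ≡.trans (≡.cong (_+_ (f k)) (·-coeff n f k)) (≡.sym (ℤ.suc-* (+ n) (f k)))

-- Kept as a product because the summands of `coefficient₂ j (const ∘ P)` have this form.
monomial : ℤ → ℕ → ℕ → ℤ
monomial a s = const a ⊛ x ^ s

monomial-zero-zero : ∀ a → monomial a 0 0 ≡ a
monomial-zero-zero a = ≡.trans (ℤₚ.const-*-coeff a (x ^ 0) 0) (ℤ.*-identityʳ a)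

monomial-zero-suc : ∀ a k → monomial a 0 (suc k) ≡ + 0
monomial-zero-suc a k = ≡.trans (ℤₚ.const-*-coeff a (x ^ 0) (suc k)) (ℤ.*-zeroʳ a)

monomial-suc-zero : ∀ a s → monomial a (suc s) 0 ≡ + 0
monomial-suc-zero a s = ≡.trans (ℤₚ.const-*-coeff a (x ^ suc s) 0)
  (≡.trans (≡.cong (a *_) (ℤₚ.X-*-zero (x ^ s))) (ℤ.*-zeroʳ a))

monomial-suc-suc : ∀ a s k → monomial a (suc s) (suc k) ≡ monomial a s k
monomial-suc-suc a s k = ≡.trans (ℤₚ.const-*-coeff a (x ^ suc s) (suc k))
  (≡.trans (≡.cong (a *_) (ℤₚ.X-*-suc (x ^ s) k)) (≡.sym (ℤₚ.const-*-coeff a (x ^ s) k)))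

sum-zero : ∀ {n} (f : Vector ℤ n) → (∀ i → f i ≡ + 0) → sum f ≡ + 0
sum-zero {zero}  f f≡0 = ≡.refl
sum-zero {suc n} f f≡0 = ≡.cong₂ _+_ (f≡0 Fin.zero) (sum-zero (f ∘ Fin.suc) (f≡0 ∘ Fin.suc))

-- Only s = k contributes. The weight `c` is an arbitrary function so that the induction can shift
-- it along with the tail of `P`; for `k` beyond the length of `P`, both sides are 0 by the default
-- of `coeff`.
weighted-coeff : ∀ {n} (c : ℤ → ℤ) (P : Vector ℤ n) k →
  sum (λ s → c (+ toℕ s) * monomial (P s) (toℕ s) k) ≡ c (+ k) * coeff P (+ k)
weighted-coeff {zero}  c P k       = ≡.sym (ℤ.*-zeroʳ (c (+ k)))
weighted-coeff {suc n} c P zero    = ≡.trans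
  (≡.cong₂ _+_ (≡.cong (c (+ 0) *_) (monomial-zero-zero (P Fin.zero)))
    (sum-zero {n} _ λ s → ≡.trans (≡.cong (c (+ suc (toℕ s)) *_) (monomial-suc-zero (P (Fin.suc s)) (toℕ s)))
      (ℤ.*-zeroʳ (c (+ suc (toℕ s))))))
  (ℤ.+-identityʳ _)
weighted-coeff {suc n} c P (suc k) = ≡.trans
  (≡.cong₂ _+_ (≡.trans (≡.cong (c (+ 0) *_) (monomial-zero-suc (P Fin.zero) k)) (ℤ.*-zeroʳ (c (+ 0))))
    (≡.trans
      (sum-cong-≗ {n} λ s → ≡.cong (c (+ suc (toℕ s)) *_) (monomial-suc-suc (P (Fin.suc s)) (toℕ s) k))
      (weighted-coeff (λ i → c (+ 1 + i)) (P ∘ Fin.suc) k)))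
  (ℤ.+-identityˡ _)

coeff-negative : ∀ {n} (P : Vector ℤ n) i → coeff P ℤ.-[1+ i ] ≡ + 0
coeff-negative {zero}  P i = ≡.refl
coeff-negative {suc n} P i = ≡.refl

-- The right-hand side is 0; it is the form taken by c k * coeff P k for k < 0.
vanishing-sum : ∀ {n} (c : ℤ → ℤ) (P : Vector ℤ n) (f : Fin n → ℤ) i → (∀ s → f s ≡ + 0) →
  sum (λ s → c (+ toℕ s) * f s) ≡ c ℤ.-[1+ i ] * coeff P ℤ.-[1+ i ]
vanishing-sum {n} c P f i f≡0 = ≡.trans
  (sum-zero {n} _ λ s → ≡.trans (≡.cong (c (+ toℕ s) *_) (f≡0 s)) (ℤ.*-zeroʳ (c (+ toℕ s))))
  (≡.sym (≡.trans (≡.cong (c ℤ.-[1+ i ] *_) (coeff-negative P i)) (ℤ.*-zeroʳ (c ℤ.-[1+ i ]))))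

-- Multiplication by `x` raises the exponent by one, so x^k selects s = k-1. For k = 0 no summand
-- qualifies and the index is -1, where `coeff` is 0.
weighted-coeff-shift : ∀ {n} (c : ℤ → ℤ) (P : Vector ℤ n) k →
  sum (λ s → c (+ toℕ s) * (x ⊛ monomial (P s) (toℕ s)) k) ≡ c (+ k - + 1) * coeff P (+ k - + 1)
weighted-coeff-shift c P zero = vanishing-sum c P _ 0 λ s → ℤₚ.X-*-zero (monomial (P s) (toℕ s))
weighted-coeff-shift {n} c P (suc k) = ≡.trans
  (sum-cong-≗ {n} λ s → ≡.cong (c (+ toℕ s) *_) (ℤₚ.X-*-suc (monomial (P s) (toℕ s)) k))
  (weighted-coeff c P k)

weighted-coeff-shift² : ∀ {n} (c : ℤ → ℤ) (P : Vector ℤ n) k →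
  sum (λ s → c (+ toℕ s) * (x ⊛ (x ⊛ monomial (P s) (toℕ s))) k)
    ≡ c (+ k - + 2) * coeff P (+ k - + 2)
-- The argument 1 encodes the index -2, since `-[1+ i ]` is -(i+1); the next clause has index -1.
weighted-coeff-shift² c P zero = vanishing-sum c P _ 1 λ s →
  ℤₚ.X-*-zero (x ⊛ monomial (P s) (toℕ s))
weighted-coeff-shift² c P (suc zero) = vanishing-sum c P _ 0 λ s →
  ≡.trans (ℤₚ.X-*-suc (x ⊛ monomial (P s) (toℕ s)) 0) (ℤₚ.X-*-zero (monomial (P s) (toℕ s)))
weighted-coeff-shift² {n} c P (suc (suc k)) = ≡.trans
  (sum-cong-≗ {n} λ s → ≡.cong (c (+ toℕ s) *_) (≡.trans
    (ℤₚ.X-*-suc (x ⊛ monomial (P s) (toℕ s)) (suc k))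
    (ℤₚ.X-*-suc (monomial (P s) (toℕ s)) k)))
  (weighted-coeff c P k)

-- Coefficients of xˢ, xˢ⁺¹, xˢ⁺² in the contribution of the monomial xˢ of P.
c₀ : ℤ → ℤ
c₀ s = + 2 * s * (s - + 1)

c₁ c₂ : ℕ → ℤ → ℤ
c₁ j s = + 4 * s * (+ 4 * + j - + 4 * s + + 1)
c₂ j s = + 16 * (+ j - s) * (+ 2 * + j - + 2 * s - + 1)

-- The factors 4 and 16 absorb the halves in the binomials: 4 C(s,2) = 2s(s-1) and 16 C(2m,2) =
-- 16m(2m-1), while 4s + 8(2m)s = 4s(4m+1). Substituting m = j-s gives `c₀`, `c₁` and `c₂`.
combination-coeff : ∀ a m s k →
  combination (2 ℕ.* m) s (monomial a s) k
  ≡ c₀ (+ s) * monomial a s k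
    + c₁ (s ℕ.+ m) (+ s) * (x ⊛ monomial a s) k
    + c₂ (s ℕ.+ m) (+ s) * (x ⊛ (x ⊛ monomial a s)) k
combination-coeff a m s k = begin
  combination n s y k
    ≡⟨ ≡.cong₂ _+_ (≡.cong₂ _+_ (··-coeff 4 (s C 2) y) (≡.cong₂ _+_ (··-coeff 4 s xy)
         (≡.trans (··-coeff 8 n (s · xy)) (≡.cong (λ z → + 8 * (+ n * z)) (·-coeff s xy k)))))
         (··-coeff 16 (n C 2) xxy) ⟩
  + 4 * (+ (s C 2) * y k) + (+ 4 * (+ s * xy k) + + 8 * (+ n * (+ s * xy k)))
    + + 16 * (+ (n C 2) * xxy k)
    ≡⟨ halve (+ (s C 2)) (+ s) (+ n) (+ (n C 2)) (y k) (xy k) (xxy k) ⟩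
  + 2 * (+ 2 * + (s C 2)) * y k + (+ 4 * + s + + 8 * + n * + s) * xy k
    + + 8 * (+ 2 * + (n C 2)) * xxy k
    ≡⟨ ≡.cong₂ (λ u v → + 2 * u * y k + (+ 4 * + s + + 8 * + n * + s) * xy k + + 8 * v * xxy k)
         (2*nC2 s) (2*nC2 n) ⟩
  + 2 * (+ s * (+ s - + 1)) * y k + (+ 4 * + s + + 8 * + n * + s) * xy k
    + + 8 * (+ n * (+ n - + 1)) * xxy k
    ≡⟨ ≡.cong (λ v → + 2 * (+ s * (+ s - + 1)) * y k + (+ 4 * + s + + 8 * v * + s) * xy k
         + + 8 * (v * (v - + 1)) * xxy k) (ℤ.pos-* 2 m) ⟩
  + 2 * (+ s * (+ s - + 1)) * y k + (+ 4 * + s + + 8 * (+ 2 * + m) * + s) * xy k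
    + + 8 * ((+ 2 * + m) * ((+ 2 * + m) - + 1)) * xxy k
    -- `+ (s ℕ.+ m)` reduces to `+ s + + m`, so the polynomial identity applies directly.
    ≡⟨ regroup (+ s) (+ m) (y k) (xy k) (xxy k) ⟩
  c₀ (+ s) * y k + c₁ (s ℕ.+ m) (+ s) * xy k + c₂ (s ℕ.+ m) (+ s) * xxy k ∎
  where
  open ≡.≡-Reasoning
  n : ℕ
  n = 2 ℕ.* m

  y xy xxy : ℕ → ℤ
  y   = monomial a s
  xy  = x ⊛ y
  xxy = x ⊛ xy

  ··-coeff : ∀ p q f → (p · (q · f)) k ≡ + p * (+ q * f k)
  ··-coeff p q f = ≡.trans (·-coeff p (q · f) k) (≡.cong (+ p *_) (·-coeff q f k))

  halve : ∀ t s n b y xy xxy →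
    + 4 * (t * y) + (+ 4 * (s * xy) + + 8 * (n * (s * xy))) + + 16 * (b * xxy)
    ≡ + 2 * (+ 2 * t) * y + (+ 4 * s + + 8 * n * s) * xy + + 8 * (+ 2 * b) * xxy
  halve = solve-∀

  regroup : ∀ s m y xy xxy →
    + 2 * (s * (s - + 1)) * y + (+ 4 * s + + 8 * (+ 2 * m) * s) * xy
      + + 8 * ((+ 2 * m) * ((+ 2 * m) - + 1)) * xxy
    ≡ + 2 * s * (s - + 1) * y
      + + 4 * s * (+ 4 * (s + m) - + 4 * s + + 1) * xy
      + + 16 * ((s + m) - s) * (+ 2 * (s + m) - + 2 * s - + 1) * xxy
  regroup = solve-∀

corollary6p2 : (j k : ℕ) (P : Vector ℤ (suc j)) → IsP j P →
    let D = coeff P in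
    A j P k 2 ≡
    + 2 * + k * (+ k - + 1) * D (+ k)
    + + 4 * (+ k - + 1) * (+ 4 * + j - + 4 * + k + + 5) * D (+ k - + 1)
    + + 16 * (+ j - + k + + 2) * (+ 2 * + j - + 2 * + k + + 3) * D (+ k - + 2)
corollary6p2 j k P _ = begin
  A j P k 2
    ≡⟨ ≡.cong (λ f → f 2 k) (generatingFunction≡series j P) ⟩
  series j (const ∘ P) 2 k
    ≡⟨ series-coeff₂-raw (SeriesRing.R⟦X⟧-commutativeRing ℤ.+-*-commutativeRing) (R⟦X⟧ ℤʳ) ≡.refl
         x j (const ∘ P) k ⟩
  coefficient₂ j (const ∘ P) k
    ≡⟨ ℤₚ.sumˢ-coeff {suc j}
         (λ s → combination (2 ℕ.* (j ℕ.∸ toℕ s)) (toℕ s) (monomial (P s) (toℕ s))) k ⟩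
  sum {suc j} (λ s → combination (2 ℕ.* (j ℕ.∸ toℕ s)) (toℕ s) (monomial (P s) (toℕ s)) k)
    ≡⟨ sum-cong-≗ {suc j} summand-coeff ⟩
  sum {suc j} (λ s → t₀ s + t₁ s + t₂ s)
    ≡⟨ ∑-distrib-+ {suc j} (λ s → t₀ s + t₁ s) t₂ ⟩
  sum {suc j} (λ s → t₀ s + t₁ s) + sum {suc j} t₂
    ≡⟨ ≡.cong (_+ sum {suc j} t₂) (∑-distrib-+ {suc j} t₀ t₁) ⟩
  sum {suc j} t₀ + sum {suc j} t₁ + sum {suc j} t₂
    ≡⟨ ≡.cong₂ _+_ (≡.cong₂ _+_ (weighted-coeff c₀ P k) (weighted-coeff-shift (c₁ j) P k))
         (weighted-coeff-shift² (c₂ j) P k) ⟩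
  c₀ (+ k) * D (+ k) + c₁ j (+ k - + 1) * D (+ k - + 1) + c₂ j (+ k - + 2) * D (+ k - + 2)
    -- The weights `c₁ j` and `c₂ j` are rewritten at s = k-1 and s = k-2: for instance 4j - 4(k-1)
    -- + 1 = 4j - 4k + 5 and 2j - 2(k-2) - 1 = 2j - 2k + 3.
    ≡⟨ reindex (+ j) (+ k) (D (+ k)) (D (+ k - + 1)) (D (+ k - + 2)) ⟩
  + 2 * + k * (+ k - + 1) * D (+ k)
    + + 4 * (+ k - + 1) * (+ 4 * + j - + 4 * + k + + 5) * D (+ k - + 1)
    + + 16 * (+ j - + k + + 2) * (+ 2 * + j - + 2 * + k + + 3) * D (+ k - + 2) ∎
  where
  open ≡.≡-Reasoning
  D : ℤ → ℤ
  D = coeff P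

  t₀ t₁ t₂ : Fin (suc j) → ℤ
  t₀ s = c₀ (+ toℕ s) * monomial (P s) (toℕ s) k
  t₁ s = c₁ j (+ toℕ s) * (x ⊛ monomial (P s) (toℕ s)) k
  t₂ s = c₂ j (+ toℕ s) * (x ⊛ (x ⊛ monomial (P s) (toℕ s))) k

  summand-coeff : ∀ s →
    combination (2 ℕ.* (j ℕ.∸ toℕ s)) (toℕ s) (monomial (P s) (toℕ s)) k ≡ t₀ s + t₁ s + t₂ s
  -- Taking m = j ∸ s yields weights at s + (j ∸ s), which is `j` because `toℕ s` is at most `j`.
  summand-coeff s = ≡.trans (combination-coeff (P s) (j ℕ.∸ toℕ s) (toℕ s) k)
    (≡.cong (λ i → t₀ s + c₁ i (+ toℕ s) * (x ⊛ monomial (P s) (toℕ s)) k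
        + c₂ i (+ toℕ s) * (x ⊛ (x ⊛ monomial (P s) (toℕ s))) k)
      (ℕ.m+[n∸m]≡n (ℕ.≤-pred (toℕ<n s))))

  reindex : ∀ j k d₀ d₁ d₂ →
    + 2 * k * (k - + 1) * d₀
      + + 4 * (k - + 1) * (+ 4 * j - + 4 * (k - + 1) + + 1) * d₁
      + + 16 * (j - (k - + 2)) * (+ 2 * j - + 2 * (k - + 2) - + 1) * d₂
    ≡ + 2 * k * (k - + 1) * d₀
      + + 4 * (k - + 1) * (+ 4 * j - + 4 * k + + 5) * d₁
      + + 16 * (j - k + + 2) * (+ 2 * j - + 2 * k + + 3) * d₂
  reindex = solve-∀
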